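{- There is an absolute constant $C$ such that for every graph $G$ with maximum degree $\Delta\geq 2$, $$\pi_{\mathrm{ch}}(G)\leq \Delta^2 + 2^{4/3} \Delta^{5/3} + C\, \Delta^{4/3}.$$ (That is, $\pi_{\mathrm{ch}}(G)\leq \Delta^2 + 2^{4/3} \Delta^{5/3} + O( \Delta^{4/3})$.)
   Context: All graphs are finite, simple and undirected. A path is a sequence of pairwise distinct vertices, consecutive ones adjacent. Given a colouring $\phi$, a sequence $(v_1,\dots,v_{2t})$ is repetitively coloured if $\phi(v_i)=\phi(v_{t+i})$ for all $i\in\{1,\dots,t\}$; a colouring is nonrepetitive if no path is repetitively coloured. A $k$-list-assignment $L$ assigns to each vertex $v$ a set $L(v)$ with $|L(v)|\ge k$; an $L$-colouring is a colouring $\phi$ with $\phi(v)\in L(v)$. $\pi_{\mathrm{ch}}(G)$ is the minimum $k$ such that $G$ has a nonrepetitive $L$-colouring for every $k$-list-assignment $L$ of $G$. -}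

module Defs where

open import Data.Nat using (ℕ; zero; suc; _+_; _*_; _≤_; _⊔_; _^_)
open import Data.Bool using (Bool; true; false; if_then_else_)
open import Data.Fin using (Fin; toℕ; _↑ˡ_; _↑ʳ_)
open import Data.List using (List; length; map; foldr; allFin)
open import Data.Nat.ListAction using (sum)
open import Data.List.Relation.Unary.Unique.Propositional using (Unique)
open import Data.List.Membership.Propositional using (_∈_)
open import Data.Product using (Σ; _×_; ∃-syntax)
open import Relation.Binary.PropositionalEquality using (_≡_)
open import Relation.Nullary using (¬_)
open import Function.Definitions using (Injective)

record Graph (n : ℕ) : Set where
  field
    adj   : Fin n → Fin n → Bool
    sym   : ∀ u v → adj u v ≡ adj v u
    irrefl : ∀ v → adj v v ≡ false
open Graph public

Adj : ∀ {n} → Graph n → Fin n → Fin n → Set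
Adj G u v = adj G u v ≡ true

degree : ∀ {n} → Graph n → Fin n → ℕ
degree {n} G v = sum (map (λ u → if adj G v u then 1 else 0) (allFin n))

maxDegree : ∀ {n} → Graph n → ℕ
maxDegree {n} G = foldr _⊔_ 0 (map (degree G) (allFin n))

IsPath : ∀ {n m} → Graph n → (Fin m → Fin n) → Set
IsPath {m = m} G p =
  Injective _≡_ _≡_ p ×
  (∀ (i j : Fin m) → toℕ j ≡ suc (toℕ i) → Adj G (p i) (p j))

Repetitive : ∀ {n} → (Fin n → ℕ) → (t : ℕ) → (Fin (t + t) → Fin n) → Set
Repetitive φ t p = ∀ (i : Fin t) → φ (p (i ↑ˡ t)) ≡ φ (p (t ↑ʳ i))

Nonrepetitive : ∀ {n} → Graph n → (Fin n → ℕ) → Set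
Nonrepetitive G φ =
  ∀ (t : ℕ) → 1 ≤ t → (p : Fin (t + t) → Fin _) → IsPath G p → ¬ Repetitive φ t p

IsKListAssignment : ∀ {n} → ℕ → (Fin n → List ℕ) → Set
IsKListAssignment k L = ∀ v → Unique (L v) × k ≤ length (L v)

πch≤ : ∀ {n} → Graph n → ℕ → Set
πch≤ {n} G k = (L : Fin n → List ℕ) → IsKListAssignment k L →
  ∃[ φ ] ((∀ v → φ v ∈ L v) × Nonrepetitive G φ)

{-# OPTIONS --safe #-}

-- Rosenfeld's counting argument.  Let N(S) be the number of colourings of all of G, with k options at every
-- vertex, in which no path inside S is repetitive.  With D = Δ², β = D + x and X = k − β, induction on |S|
-- gives β N(S) ≤ k N(S ∪ {v}) for v ∉ S: a colouring that is good on S but not on S ∪ {v} has a repetition on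
-- some path of 2t vertices with v in its first half R, and the colours on R are then determined by those
-- outside R, so k^t times the number of such colourings is at most N(S ∖ R), which the induction hypothesis
-- bounds by (k/β)^(t−1) N(S).  There are at most t Δ^(2t−1) such paths, and ∑ t Δ^(2t−1) β^(1−t) ≤ Δ β² / x²,
-- so it suffices that Δ β² ≤ x² X; this holds for x = ⌊(k − D)/2⌋ and C = 32.
module Submission where

open import Defs hiding (sym)
open import Data.Bool as Bool using (Bool; true; false; if_then_else_)
open import Data.Nat
open import Data.Nat.ListAction using (sum)
open import Data.Nat.Properties
open import Data.Nat.Tactic.RingSolver using (solve-∀)
open import Data.Fin as Fin using (Fin; zero; suc; toℕ; _↑ˡ_; _↑ʳ_)
import Data.Fin.Properties as Fin
open import Data.List using (List; []; _∷_; _++_; _ʳ++_; map; concatMap; cartesianProductWith; filter; foldr; reverse; take; drop; length; lookup; upTo; downFrom; allFin; tabulate)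
open import Data.List.Properties hiding (sum-++)
import Data.List.Membership.DecPropositional as DecMembership
open import Data.List.Membership.Propositional using (_∈_; _∉_; find; lose)
open import Data.List.Membership.Propositional.Properties
open import Data.List.Relation.Binary.Permutation.Propositional using (↭⇒↭ₛ; ↭-sym)
open import Data.List.Relation.Binary.Permutation.Propositional.Properties using (↭-reverse)
import Data.List.Relation.Binary.Permutation.Setoid.Properties as Permutationₛ
open import Data.List.Relation.Binary.Subset.Propositional using (_⊆_)
open import Data.List.Relation.Unary.All as All using (All; []; _∷_)
import Data.List.Relation.Unary.All.Properties as All
open import Data.List.Relation.Unary.AllPairs using ([]; _∷_)
open import Data.List.Relation.Unary.Any as Any using (Any; here; there)
open import Data.List.Relation.Unary.Linked using (Linked; []; [-]; _∷_)
import Data.List.Relation.Unary.Unique.DecPropositional as DecUnique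
open import Data.List.Relation.Unary.Unique.Propositional using (Unique)
import Data.List.Relation.Unary.Unique.Propositional.Properties as Unique
open import Data.Product using (∃; ∃-syntax; _×_; _,_; proj₁; proj₂)
open import Data.Sum using (inj₁; inj₂)
open import Data.Vec as Vec using (Vec; []; _∷_; _[_]≔_)
open import Data.Vec.Properties using (lookup∘update; lookup∘update′)
open import Function using (_∘_; case_of_)
open import Relation.Binary using (Symmetric)
open import Relation.Binary.PropositionalEquality
open import Relation.Nullary
open import Relation.Nullary.Decidable using (map′; _×-dec_; ¬?)
open import Relation.Unary using (Decidable)

private variable
  A B : Set

-- Counting colourings

∑ : List A → (A → ℕ) → ℕ
∑ xs f = sum (map f xs)

∑-mono : ∀ (xs : List A) {f g : A → ℕ} → (∀ {x} → x ∈ xs → f x ≤ g x) → ∑ xs f ≤ ∑ xs g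
∑-mono []       f≤g = z≤n
∑-mono (x ∷ xs) f≤g = +-mono-≤ (f≤g (here refl)) (∑-mono xs (f≤g ∘ there))

∑-zero : ∀ (xs : List A) → ∑ xs (λ _ → 0) ≡ 0
∑-zero []       = refl
∑-zero (x ∷ xs) = ∑-zero xs

∑-distrib-+ : ∀ (xs : List A) (f g : A → ℕ) → ∑ xs (λ x → f x + g x) ≡ ∑ xs f + ∑ xs g
∑-distrib-+ []       f g = refl
∑-distrib-+ (x ∷ xs) f g rewrite ∑-distrib-+ xs f g = lemma (f x) (g x) (∑ xs f) (∑ xs g)
  where
  lemma : ∀ a b c d → a + b + (c + d) ≡ a + c + (b + d)
  lemma = solve-∀

*-distribˡ-∑ : ∀ (xs : List A) m (f : A → ℕ) → m * ∑ xs f ≡ ∑ xs (λ x → m * f x)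
*-distribˡ-∑ []       m f = *-zeroʳ m
*-distribˡ-∑ (x ∷ xs) m f rewrite *-distribˡ-+ m (f x) (∑ xs f) =
  cong (m * f x +_) (*-distribˡ-∑ xs m f)

∑-const : ∀ (xs : List A) m → ∑ xs (λ _ → m) ≡ length xs * m
∑-const []       m = refl
∑-const (x ∷ xs) m = cong (m +_) (∑-const xs m)

∑-cong : ∀ (xs : List A) {f g : A → ℕ} → (∀ x → f x ≡ g x) → ∑ xs f ≡ ∑ xs g
∑-cong []       f≡g = refl
∑-cong (x ∷ xs) f≡g = cong₂ _+_ (f≡g x) (∑-cong xs f≡g)

∑-comm : ∀ (xs : List A) (ys : List B) (f : A → B → ℕ) →
         ∑ xs (λ x → ∑ ys (f x)) ≡ ∑ ys (λ y → ∑ xs (λ x → f x y))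
∑-comm []       ys f = sym (∑-zero ys)
∑-comm (x ∷ xs) ys f rewrite ∑-comm xs ys f = sym (∑-distrib-+ ys (f x) _)

∈⇒≤∑ : ∀ {xs : List A} {x} (f : A → ℕ) → x ∈ xs → f x ≤ ∑ xs f
∈⇒≤∑ f (here refl) = m≤m+n _ _
∈⇒≤∑ f (there x∈)  = ≤-trans (∈⇒≤∑ f x∈) (m≤n+m _ _)

𝟙 : Dec A → ℕ
𝟙 P? = if does P? then 1 else 0

𝟙-mono : (P? : Dec A) (Q? : Dec B) → (A → B) → 𝟙 P? ≤ 𝟙 Q?
𝟙-mono (no _)  _       _ = z≤n
𝟙-mono (yes p) (yes _) _ = ≤-refl
𝟙-mono (yes p) (no ¬q) f = contradiction (f p) ¬q

𝟙≤ : (P? : Dec A) {m : ℕ} → (A → 1 ≤ m) → 𝟙 P? ≤ m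
𝟙≤ (yes p) f = f p
𝟙≤ (no _)  _ = z≤n

1≤𝟙 : (P? : Dec A) → A → 1 ≤ 𝟙 P?
1≤𝟙 P? p = 𝟙-mono (yes p) P? λ p → p

-- ∫ f sums f over all k ^ n colourings; for the indicator of a property it counts them.
module _ {k : ℕ} where

  ∫ : ∀ {n} → (Vec (Fin k) n → ℕ) → ℕ
  ∫ {zero}  f = f []
  ∫ {suc n} f = ∑ (allFin k) λ c → ∫ (f ∘ (c ∷_))

  ∫-mono : ∀ {n} {f g : Vec (Fin k) n → ℕ} → (∀ φ → f φ ≤ g φ) → ∫ f ≤ ∫ g
  ∫-mono {zero}  f≤g = f≤g []
  ∫-mono {suc n} f≤g = ∑-mono (allFin k) λ {c} _ → ∫-mono (f≤g ∘ (c ∷_))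

  ∫-distrib-+ : ∀ {n} (f g : Vec (Fin k) n → ℕ) → ∫ (λ φ → f φ + g φ) ≡ ∫ f + ∫ g
  ∫-distrib-+ {zero}  f g = refl
  ∫-distrib-+ {suc n} f g = trans
    (∑-cong (allFin k) λ c → ∫-distrib-+ (f ∘ (c ∷_)) (g ∘ (c ∷_)))
    (∑-distrib-+ (allFin k) _ _)

  ∫-∑ : ∀ {n} (xs : List A) (f : A → Vec (Fin k) n → ℕ) →
        ∫ (λ φ → ∑ xs λ x → f x φ) ≡ ∑ xs (∫ ∘ f)
  ∫-∑ {n = zero}  xs f = refl
  ∫-∑ {n = suc n} xs f = trans
    (∑-cong (allFin k) λ c → ∫-∑ xs (λ x → f x ∘ (c ∷_)))
    (∑-comm (allFin k) xs _)

  -- Every colouring equals `φ [ r ]≔ c` for exactly `k` pairs `(φ, c)`: `c` is forced to be its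
  -- colour at `r`, while the colour of `φ` at `r` is free.
  ∫-resample : ∀ {n} (f : Vec (Fin k) n → ℕ) (r : Fin n) →
               ∫ (λ φ → ∑ (allFin k) λ c → f (φ [ r ]≔ c)) ≡ k * ∫ f
  ∫-resample {suc n} f zero = begin
    ∑ (allFin k) (λ _ → ∫ λ φ → ∑ (allFin k) λ c → f (c ∷ φ))
      ≡⟨ ∑-const (allFin k) _ ⟩
    length (allFin k) * ∫ (λ φ → ∑ (allFin k) λ c → f (c ∷ φ))
      ≡⟨ cong₂ _*_ (length-tabulate {n = k} (λ i → i)) (∫-∑ (allFin k) λ c φ → f (c ∷ φ)) ⟩
    k * ∫ f ∎
    where open ≡-Reasoning
  ∫-resample {suc n} f (suc r) = trans
    (∑-cong (allFin k) λ c → ∫-resample (f ∘ (c ∷_)) r)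
    (sym (*-distribˡ-∑ (allFin k) k _))

  ∫-positive : .{{_ : NonZero k}} → ∀ {n} {f : Vec (Fin k) n → ℕ} → (∀ φ → 1 ≤ f φ) → 1 ≤ ∫ f
  ∫-positive {zero}      1≤f = 1≤f []
  ∫-positive {suc n} {f} 1≤f = ≤-trans (∫-positive (1≤f ∘ (c₀ ∷_)))
    (∈⇒≤∑ (λ c → ∫ (f ∘ (c ∷_))) (∈-allFin c₀))
    where
    c₀ : Fin k
    c₀ = Fin.fromℕ< (>-nonZero⁻¹ k)

  ∫-witness : ∀ {n} {P : Vec (Fin k) n → Set} (P? : Decidable P) → 1 ≤ ∫ (𝟙 ∘ P?) → ∃ P
  ∫-witness {zero} P? pos with P? []
  ... | yes p = [] , p
  ... | no  _ = contradiction pos λ()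
  ∫-witness {suc n} P? pos with any-pos (allFin k) pos
    where
    any-pos : ∀ (xs : List A) {f : A → ℕ} → 1 ≤ ∑ xs f → ∃ λ x → 1 ≤ f x
    any-pos (x ∷ xs) {f} pos with f x in eq
    ... | zero  = any-pos xs pos
    ... | suc _ = x , subst (1 ≤_) (sym eq) (s≤s z≤n)
  ... | c , pos′ with ∫-witness (P? ∘ (c ∷_)) pos′
  ...   | φ , p = c ∷ φ , p

∑-unique≤1 : ∀ {P : A → Set} (P? : Decidable P) → (∀ {x y} → P x → P y → x ≡ y) →
             ∀ {xs} → Unique xs → ∑ xs (𝟙 ∘ P?) ≤ 1
∑-unique≤1 P? P-prop []       = z≤n
∑-unique≤1 P? P-prop {x ∷ xs} (x∉ ∷ uniq) with P? x
... | no  _ = ∑-unique≤1 P? P-prop uniq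
-- Once `x` satisfies `P`, every later indicator vanishes: it is compared with that of an empty
-- type.
... | yes p = s≤s (≤-trans (∑-mono xs λ {y} y∈ → 𝟙-mono (P? y) (no (λ ())) λ q →
    All.lookup x∉ y∈ (P-prop p q)) (≤-reflexive (∑-zero xs)))

-- A colouring is a vector of indices into the `k` options of each vertex, whereas repetitions
-- compare the colours themselves, so the options of different vertices may overlap arbitrarily.
-- Injectivity says that a given colour is attained by at most one index.
module Colourings {n k : ℕ} (option : Fin n → Fin k → ℕ)
                  (option-injective : ∀ v {c d} → option v c ≡ option v d → c ≡ d) where

  colour : Vec (Fin k) n → Fin n → ℕ
  colour φ v = option v (Vec.lookup φ v)

  colour-update : ∀ φ v c → colour (φ [ v ]≔ c) v ≡ option v c
  colour-update φ v c = cong (option v) (lookup∘update v φ c)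

  colour-update-≢ : ∀ φ {u v} c → u ≢ v → colour (φ [ v ]≔ c) u ≡ colour φ u
  colour-update-≢ φ {u} c u≢v = cong (option u) (lookup∘update′ u≢v φ c)

  IgnoresColourOf : (Vec (Fin k) n → ℕ) → Fin n → Set
  IgnoresColourOf f v = ∀ φ c → f (φ [ v ]≔ c) ≡ f φ

  -- With `φ` fixed off `r`, both `f φ` and the colour of `s` are fixed, and at most one of the `k`
  -- options at `r` equals the latter. Resampling the colour at `r` turns this into the factor `k`.
  ∫-match : ∀ {r s} (f : Vec (Fin k) n → ℕ) → r ≢ s → IgnoresColourOf f r →
            k * ∫ (λ φ → f φ * 𝟙 (colour φ r ≟ colour φ s)) ≤ ∫ f
  ∫-match {r} {s} f r≢s ignores = begin
    k * ∫ g                                           ≡⟨ ∫-resample g r ⟨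
    ∫ (λ φ → ∑ (allFin k) λ c → g (φ [ r ]≔ c))       ≤⟨ ∫-mono resampled ⟩
    ∫ f                                               ∎
    where
    open ≤-Reasoning
    g = λ φ → f φ * 𝟙 (colour φ r ≟ colour φ s)
    resampled : ∀ φ → ∑ (allFin k) (λ c → g (φ [ r ]≔ c)) ≤ f φ
    resampled φ = begin
      ∑ (allFin k) (λ c → g (φ [ r ]≔ c))
        ≡⟨ ∑-cong (allFin k) (λ c → cong₂ _*_ (ignores φ c)
             (cong₂ (λ a b → 𝟙 (a ≟ b)) (colour-update φ r c) (colour-update-≢ φ c (r≢s ∘ sym)))) ⟩
      ∑ (allFin k) (λ c → f φ * 𝟙 (option r c ≟ colour φ s))
        ≡⟨ *-distribˡ-∑ (allFin k) (f φ) _ ⟨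
      f φ * ∑ (allFin k) (λ c → 𝟙 (option r c ≟ colour φ s))
        ≤⟨ *-monoʳ-≤ (f φ) (∑-unique≤1 (λ c → option r c ≟ colour φ s)
             (λ p q → option-injective r (trans p (sym q))) (Unique.allFin⁺ k)) ⟩
      f φ * 1 ≡⟨ *-identityʳ (f φ) ⟩
      f φ ∎

  -- The condition is kept as a product so that `∫-match` can remove one factor at a time; the
  -- factor of the heads stands last to be split off by associativity.
  matches : List (Fin n) → List (Fin n) → Vec (Fin k) n → ℕ
  matches (r ∷ rs) (s ∷ ss) φ = matches rs ss φ * 𝟙 (colour φ r ≟ colour φ s)
  matches _        _        φ = 1

  matches-ignores : ∀ {v} rs ss → All (v ≢_) rs → All (v ≢_) ss → IgnoresColourOf (matches rs ss) v
  matches-ignores []       _  _ _ φ c = refl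
  matches-ignores (_ ∷ _)  [] _ _ φ c = refl
  matches-ignores (r ∷ rs) (s ∷ ss) (v≢r ∷ v≢rs) (v≢s ∷ v≢ss) φ c =
    cong₂ _*_ (matches-ignores rs ss v≢rs v≢ss φ c)
      (cong₂ (λ a b → 𝟙 (a ≟ b)) (colour-update-≢ φ c (v≢r ∘ sym)) (colour-update-≢ φ c (v≢s ∘ sym)))

  ≡⇒matches : ∀ rs ss φ → map (colour φ) rs ≡ map (colour φ) ss → 1 ≤ matches rs ss φ
  ≡⇒matches []       _        φ _  = ≤-refl
  ≡⇒matches (_ ∷ _)  []       φ _  = ≤-refl
  ≡⇒matches (r ∷ rs) (s ∷ ss) φ eq = *-mono-≤ (≡⇒matches rs ss φ (∷-injectiveʳ eq))
    (1≤𝟙 (colour φ r ≟ colour φ s) (∷-injectiveˡ eq))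

  -- The vertices of `rs` are peeled off one by one, each yielding a factor `k`. As `r` occurs
  -- neither in the rest of `rs` nor in `ss`, the remaining product ignores its colour, as `∫-match`
  -- requires.
  ∫-matches : ∀ (f : Vec (Fin k) n → ℕ) rs ss → Unique rs → All (λ r → All (r ≢_) ss) rs →
              length rs ≡ length ss → All (IgnoresColourOf f) rs →
              k ^ length rs * ∫ (λ φ → f φ * matches rs ss φ) ≤ ∫ f
  ∫-matches f [] ss _ _ _ _ rewrite *-identityˡ (∫ λ φ → f φ * 1) =
    ∫-mono λ φ → ≤-reflexive (*-identityʳ (f φ))
  ∫-matches f (r ∷ rs) (s ∷ ss) (r∉rs ∷ uniq) ((r≢s ∷ r∉ss) ∷ disj) len (ign ∷ igns) = begin
    k * k ^ length rs * ∫ (λ φ → f φ * (matches rs ss φ * 𝟙 (colour φ r ≟ colour φ s)))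
      ≤⟨ *-monoʳ-≤ (k * k ^ length rs) (∫-mono λ φ →
           ≤-reflexive (sym (*-assoc (f φ) (matches rs ss φ) _))) ⟩
    k * k ^ length rs * ∫ (λ φ → f φ * matches rs ss φ * 𝟙 (colour φ r ≟ colour φ s))
      ≡⟨ swap k (k ^ length rs) _ ⟩
    k ^ length rs * (k * ∫ (λ φ → f φ * matches rs ss φ * 𝟙 (colour φ r ≟ colour φ s)))
      ≤⟨ *-monoʳ-≤ (k ^ length rs) (∫-match (λ φ → f φ * matches rs ss φ) r≢s
           λ φ c → cong₂ _*_ (ign φ c) (matches-ignores rs ss r∉rs r∉ss φ c)) ⟩
    k ^ length rs * ∫ (λ φ → f φ * matches rs ss φ)
      ≤⟨ ∫-matches f rs ss uniq (All.map All.tail disj) (suc-injective len) igns ⟩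
    ∫ f ∎
    where
    open ≤-Reasoning
    swap : ∀ a b c → a * b * c ≡ b * (a * c)
    swap = solve-∀

-- Paths through a vertex

length-concatMap : ∀ (f : A → List B) xs → length (concatMap f xs) ≡ ∑ xs (length ∘ f)
length-concatMap f []       = refl
length-concatMap f (x ∷ xs) =
  trans (length-++ (f x)) (cong (length (f x) +_) (length-concatMap f xs))

length-cartesianProductWith : ∀ {C : Set} (f : A → B → C) xs ys →
  length (cartesianProductWith f xs ys) ≡ length xs * length ys
length-cartesianProductWith f []       ys = refl
length-cartesianProductWith f (x ∷ xs) ys = trans (length-++ (map (f x) ys))
  (cong₂ _+_ (length-map (f x) ys) (length-cartesianProductWith f xs ys))

reverse-++-∷ : ∀ (xs : List A) y ys → reverse (xs ++ y ∷ ys) ≡ reverse ys ++ y ∷ reverse xs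
reverse-++-∷ xs y ys = trans (++-ʳ++ xs) (ʳ++-defn ys)

take-length-++ : ∀ (xs : List A) {ys} → take (length xs) (xs ++ ys) ≡ xs
take-length-++ []       = refl
take-length-++ (x ∷ xs) = cong (x ∷_) (take-length-++ xs)

drop-length-++ : ∀ (xs : List A) {ys} → drop (length xs) (xs ++ ys) ≡ ys
drop-length-++ []       = refl
drop-length-++ (x ∷ xs) = drop-length-++ xs

∈-take-++ : ∀ {t} (xs : List A) {y ys} → length xs < t → y ∈ take t (xs ++ y ∷ ys)
∈-take-++ []       (s≤s _)   = here refl
∈-take-++ (x ∷ xs) (s≤s len) = there (∈-take-++ xs len)

module _ {R : A → A → Set} where

  Linked-suffix : ∀ xs {ys} → Linked R (xs ++ ys) → Linked R ys
  Linked-suffix []           linked       = linked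
  Linked-suffix (x ∷ [])     [-]          = []
  Linked-suffix (x ∷ [])     (_ ∷ linked) = linked
  Linked-suffix (x ∷ y ∷ xs) (_ ∷ linked) = Linked-suffix (y ∷ xs) linked

  -- Two walks leaving `x` are glued at `x` by running the first one backwards.
  Linked-ʳ++ : Symmetric R → ∀ {x} xs {ys} → Linked R (x ∷ xs) → Linked R (x ∷ ys) → Linked R (xs ʳ++ x ∷ ys)
  Linked-ʳ++ R-sym []       _              linked = linked
  Linked-ʳ++ R-sym (y ∷ xs) (Rxy ∷ linked) linked′ = Linked-ʳ++ R-sym xs linked (R-sym Rxy ∷ linked′)

  Linked-reverse : Symmetric R → ∀ {xs} → Linked R xs → Linked R (reverse xs)
  Linked-reverse R-sym {[]}     _      = []
  Linked-reverse R-sym {x ∷ xs} linked = Linked-ʳ++ R-sym xs linked [-]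

Unique-reverse : ∀ {xs : List A} → Unique xs → Unique (reverse xs)
Unique-reverse {xs = xs} = Permutationₛ.Unique-resp-↭ (setoid _) (↭⇒↭ₛ (↭-sym (↭-reverse xs)))

HalvesAgree : (A → B) → ℕ → List A → Set
HalvesAgree f t xs = map f (take t xs) ≡ map f (drop t xs)

module _ {t} {xs : List A} (len : length xs ≡ t + t) where

  length-first-half : length (take t xs) ≡ t
  length-first-half = trans (length-take t xs) (trans (cong (t ⊓_) len) (m≤n⇒m⊓n≡m (m≤m+n t t)))

  length-second-half : length (drop t xs) ≡ t
  length-second-half = trans (length-drop t xs) (trans (cong (_∸ t) len) (m+n∸m≡n t t))

  -- Reversal exchanges the two halves and reverses each of them, so halves with equal colour
  -- sequences keep equal colour sequences.
  HalvesAgree-reverse : ∀ {f : A → B} → HalvesAgree f t xs → HalvesAgree f t (reverse xs)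
  HalvesAgree-reverse {f = f} agree = begin
    map f (take t (reverse xs))  ≡⟨ cong (map f) (proj₁ halves) ⟩
    map f (reverse (drop t xs))  ≡⟨ reverse-map f (drop t xs) ⟩
    reverse (map f (drop t xs))  ≡⟨ cong reverse agree ⟨
    reverse (map f (take t xs))  ≡⟨ reverse-map f (take t xs) ⟨
    map f (reverse (take t xs))  ≡⟨ cong (map f) (proj₂ halves) ⟨
    map f (drop t (reverse xs))  ∎
    where
    open ≡-Reasoning
    as = reverse (drop t xs)
    bs = reverse (take t xs)
    split : reverse xs ≡ as ++ bs
    split = trans (cong reverse (sym (take++drop≡id t xs))) (reverse-++ (take t xs) (drop t xs))
    length-as : length as ≡ t
    length-as = trans (length-reverse (drop t xs)) length-second-half
    halves : take t (reverse xs) ≡ as × drop t (reverse xs) ≡ bs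
    halves rewrite split = subst (λ s → take s (as ++ bs) ≡ as × drop s (as ++ bs) ≡ bs) length-as
      (take-length-++ as , drop-length-++ as)

sum-if≡length-filter : ∀ (f : A → Bool) xs →
  sum (map (λ x → if f x then 1 else 0) xs) ≡ length (filter (λ x → f x Bool.≟ true) xs)
sum-if≡length-filter f []       = refl
sum-if≡length-filter f (x ∷ xs) with f x
... | true  = cong suc (sum-if≡length-filter f xs)
... | false = sum-if≡length-filter f xs

module Walks {n} (G : Graph n) where

  Adj-sym : Symmetric (Adj G)
  Adj-sym {u} {v} uv = trans (Graph.sym G v u) uv

  neighbours : Fin n → List (Fin n)
  neighbours v = filter (λ u → adj G v u Bool.≟ true) (allFin n)

  length-neighbours : ∀ v → length (neighbours v) ≡ degree G v
  length-neighbours v = sym (sum-if≡length-filter (adj G v) (allFin n))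

  -- The start `v` is left out of the lists, so that two walks from `v` can be glued without
  -- doubling it. Vertices may recur: an overcount of the paths is all that the argument needs.
  walks : ℕ → Fin n → List (List (Fin n))
  walks zero    v = [] ∷ []
  walks (suc m) v = concatMap (λ u → map (u ∷_) (walks m u)) (neighbours v)

  ∈-walks⁺ : ∀ {v} xs → Linked (Adj G) (v ∷ xs) → xs ∈ walks (length xs) v
  ∈-walks⁺ []       _              = here refl
  ∈-walks⁺ (u ∷ xs) (vu ∷ linked) = ∈-concatMap⁺ _
    (lose (∈-filter⁺ _ (∈-allFin u) vu) (∈-map⁺ (u ∷_) (∈-walks⁺ xs linked)))

  ∈-walks⁻ : ∀ m {v xs} → xs ∈ walks m v → Linked (Adj G) (v ∷ xs) × length xs ≡ m
  ∈-walks⁻ zero    (here refl) = [-] , refl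
  ∈-walks⁻ (suc m) {v} xs∈
    with u , u∈ , xs∈map ← find (∈-concatMap⁻ (λ u → map (u ∷_) (walks m u)) {xs = neighbours v} xs∈)
    with ys , ys∈ , refl ← ∈-map⁻ (u ∷_) xs∈map
    with linked , len ← ∈-walks⁻ m ys∈
    = proj₂ (∈-filter⁻ (λ u → adj G v u Bool.≟ true) {xs = allFin n} u∈) ∷ linked , cong suc len

  through : Fin n → List (Fin n) → List (Fin n) → List (Fin n)
  through v pre post = pre ʳ++ v ∷ post

  -- Here `i` is the number of vertices before `v`. They form a walk outward from `v`, which
  -- `through` reverses. `pathsThrough` takes only `i < t`, which puts `v` into the first half.
  pathsThroughAt : ℕ → Fin n → ℕ → List (List (Fin n))
  pathsThroughAt t v i = cartesianProductWith (through v) (walks i v) (walks (t + t ∸ suc i) v)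

  pathsThrough : ℕ → Fin n → List (List (Fin n))
  pathsThrough t v = concatMap (pathsThroughAt t v) (upTo t)

  ∈-pathsThrough⁻ : ∀ {t v xs} → xs ∈ pathsThrough t v →
                    Linked (Adj G) xs × length xs ≡ t + t × v ∈ take t xs
  ∈-pathsThrough⁻ {t} {v} xs∈
    with i , i∈ , xs∈′ ← find (∈-concatMap⁻ (pathsThroughAt t v) xs∈)
    with pre , post , pre∈ , post∈ , refl ← ∈-cartesianProductWith⁻ (through v) (walks i v) _ xs∈′
    with linked₁ , refl ← ∈-walks⁻ i pre∈
    with linked₂ , len ← ∈-walks⁻ (t + t ∸ suc i) post∈
    = Linked-ʳ++ Adj-sym pre linked₁ linked₂
    , length-through
    , subst (λ xs → v ∈ take t xs) (sym (ʳ++-defn pre))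
        (∈-take-++ (reverse pre) (subst (_< t) (sym (length-reverse pre)) i<t))
    where
    i<t : length pre < t
    i<t = ∈-upTo⁻ i∈
    length-through : length (pre ʳ++ v ∷ post) ≡ t + t
    length-through = begin
      length (pre ʳ++ v ∷ post)                        ≡⟨ length-ʳ++ pre ⟩
      length pre + suc (length post)                   ≡⟨ +-suc _ _ ⟩
      suc (length pre) + length post                   ≡⟨ cong (suc (length pre) +_) len ⟩
      suc (length pre) + (t + t ∸ suc (length pre))    ≡⟨ m+[n∸m]≡n (m≤n⇒m≤n+o t i<t) ⟩
      t + t                                            ∎
      where open ≡-Reasoning

  ∈-pathsThrough⁺ : ∀ {t v} ys {zs} → Linked (Adj G) (ys ++ v ∷ zs) → length (ys ++ v ∷ zs) ≡ t + t →
                    length ys < t → ys ++ v ∷ zs ∈ pathsThrough t v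
  ∈-pathsThrough⁺ {t} {v} ys {zs} linked len i<t = ∈-concatMap⁺ _ (lose (∈-upTo⁺ i<t)
    (subst (_∈ pathsThroughAt t v (length ys))
      (trans (ʳ++-defn (reverse ys)) (cong (_++ v ∷ zs) (reverse-involutive ys)))
      (∈-cartesianProductWith⁺ (through v)
        -- The part before `v` has to be read as a walk starting at `v`, hence backwards.
        (subst (λ i → reverse ys ∈ walks i v) (length-reverse ys)
          (∈-walks⁺ (reverse ys) (Linked-suffix (reverse zs) (subst (Linked (Adj G)) rev (Linked-reverse Adj-sym linked)))))
        (subst (λ j → zs ∈ walks j v) length-zs (∈-walks⁺ zs (Linked-suffix ys linked))))))
    where
    rev = reverse-++-∷ ys v zs
    length-zs : length zs ≡ t + t ∸ suc (length ys)
    length-zs = begin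
      length zs                                               ≡⟨ m+n∸m≡n (suc (length ys)) _ ⟨
      suc (length ys) + length zs ∸ suc (length ys)           ≡⟨ cong (_∸ suc (length ys)) (+-suc (length ys) _) ⟨
      length ys + suc (length zs) ∸ suc (length ys)           ≡⟨ cong (_∸ suc (length ys)) (length-++ ys) ⟨
      length (ys ++ v ∷ zs) ∸ suc (length ys)                 ≡⟨ cong (_∸ suc (length ys)) len ⟩
      t + t ∸ suc (length ys)                                 ∎
      where open ≡-Reasoning

  -- Distinctness of the vertices is demanded here and not in `pathsThrough`, so that walks can be
  -- enumerated while only repetitions on genuine paths count.
  record Repetition (f : Fin n → ℕ) (t : ℕ) (xs : List (Fin n)) : Set where
    constructor repetition
    field
      unique : Unique xs
      agree  : HalvesAgree f t xs

  -- A repetition and its reversal together put each of their vertices into a first half.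
  refocus : ∀ {f t v xs} → Linked (Adj G) xs → length xs ≡ t + t → Repetition f t xs → v ∈ xs →
            ∃ λ ys → ys ∈ pathsThrough t v × Repetition f t ys
  refocus {t = t} linked len rep v∈ with ∈-∃++ v∈
  ... | ys , zs , refl with length ys <? t
  ...   | yes i<t = ys ++ _ ∷ zs , ∈-pathsThrough⁺ ys linked len i<t , rep
  ...   | no  i≮t = reverse (ys ++ _ ∷ zs)
                  , subst (_∈ pathsThrough t _) (sym rev)
                      (∈-pathsThrough⁺ (reverse zs) (subst (Linked (Adj G)) rev (Linked-reverse Adj-sym linked))
                        (trans (cong length (sym rev)) (trans (length-reverse (ys ++ _ ∷ zs)) len))
                        (subst (_< t) (sym (length-reverse zs)) j<t))
                  , repetition (Unique-reverse (Repetition.unique rep)) (HalvesAgree-reverse len (Repetition.agree rep))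
    where
    rev = reverse-++-∷ ys _ zs
    j<t : length zs < t
    j<t = +-cancelˡ-≤ t _ _ (begin
      t + suc (length zs)           ≤⟨ +-monoˡ-≤ _ (≮⇒≥ i≮t) ⟩
      length ys + suc (length zs)   ≡⟨ length-++ ys ⟨
      length (ys ++ _ ∷ zs)         ≡⟨ len ⟩
      t + t                         ∎)
      where open ≤-Reasoning

  module _ {Δ} (degree≤Δ : ∀ v → degree G v ≤ Δ) where

    length-walks : ∀ m v → length (walks m v) ≤ Δ ^ m
    length-walks zero    v = ≤-refl
    length-walks (suc m) v = begin
      length (walks (suc m) v)                                       ≡⟨ length-concatMap _ (neighbours v) ⟩
      ∑ (neighbours v) (λ u → length (map (u ∷_) (walks m u)))       ≤⟨ ∑-mono (neighbours v) (λ {u} _ →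
        ≤-trans (≤-reflexive (length-map (u ∷_) (walks m u))) (length-walks m u)) ⟩
      ∑ (neighbours v) (λ _ → Δ ^ m)                                 ≡⟨ ∑-const (neighbours v) (Δ ^ m) ⟩
      length (neighbours v) * Δ ^ m                                  ≤⟨ *-monoˡ-≤ (Δ ^ m) (≤-trans (≤-reflexive (length-neighbours v)) (degree≤Δ v)) ⟩
      Δ ^ suc m                                                      ∎
      where open ≤-Reasoning

    -- There are `t + 1` positions for `v`. At each of them the two walks have `2t + 1` steps in
    -- total, wherever `v` stands. The power of `Δ` is split as `(Δ * Δ) ^ t * Δ` to fit a geometric
    -- series in `Δ²`.
    length-pathsThrough : ∀ t v → length (pathsThrough (suc t) v) ≤ suc t * ((Δ * Δ) ^ t * Δ)
    length-pathsThrough t v = begin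
      length (pathsThrough (suc t) v)
        ≡⟨ length-concatMap (pathsThroughAt (suc t) v) (upTo (suc t)) ⟩
      ∑ (upTo (suc t)) (λ i → length (pathsThroughAt (suc t) v i))
        ≤⟨ ∑-mono (upTo (suc t)) (λ {i} i∈ → position i (∈-upTo⁻ i∈)) ⟩
      ∑ (upTo (suc t)) (λ _ → (Δ * Δ) ^ t * Δ)
        ≡⟨ ∑-const (upTo (suc t)) _ ⟩
      length (upTo (suc t)) * ((Δ * Δ) ^ t * Δ)
        ≡⟨ cong (_* ((Δ * Δ) ^ t * Δ)) (length-upTo (suc t)) ⟩
      suc t * ((Δ * Δ) ^ t * Δ) ∎
      where
      open ≤-Reasoning
      exponent : Δ ^ (t + suc t) ≡ (Δ * Δ) ^ t * Δ
      exponent = begin-equality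
        Δ ^ (t + suc t)        ≡⟨ cong (Δ ^_) (e t) ⟩
        Δ ^ (2 * t + 1)        ≡⟨ ^-distribˡ-+-* Δ (2 * t) 1 ⟩
        Δ ^ (2 * t) * (Δ * 1)  ≡⟨ cong₂ _*_ (sym (^-*-assoc Δ 2 t)) (*-identityʳ Δ) ⟩
        (Δ ^ 2) ^ t * Δ        ≡⟨ cong (λ D → (Δ * D) ^ t * Δ) (*-identityʳ Δ) ⟩
        (Δ * Δ) ^ t * Δ        ∎
        where
        e : ∀ t → t + suc t ≡ 2 * t + 1
        e = solve-∀
      position : ∀ i → i < suc t →
        length (pathsThroughAt (suc t) v i) ≤ (Δ * Δ) ^ t * Δ
      position i i<t = begin
        length (pathsThroughAt (suc t) v i)
          ≡⟨ length-cartesianProductWith (through v) (walks i v) _ ⟩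
        length (walks i v) * length (walks (t + suc t ∸ i) v)
          ≤⟨ *-mono-≤ (length-walks i v) (length-walks (t + suc t ∸ i) v) ⟩
        Δ ^ i * Δ ^ (t + suc t ∸ i)
          ≡⟨ ^-distribˡ-+-* Δ i _ ⟨
        Δ ^ (i + (t + suc t ∸ i))
          ≡⟨ cong (Δ ^_) (m+[n∸m]≡n (m≤n⇒m≤o+n t (<⇒≤ i<t))) ⟩
        Δ ^ (t + suc t)
          ≡⟨ exponent ⟩
        (Δ * Δ) ^ t * Δ ∎

-- Arithmetic

module _ (Δ x : ℕ) where

  private
    D = Δ * Δ
    β = D + x

  -- geomSum T = ∑_{t < T} (t + 1) D^t β^(T - 1 - t).
  geomSum : ℕ → ℕ
  geomSum zero    = 0
  geomSum (suc T) = β * geomSum T + suc T * D ^ T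

  -- The closed form of geomSum T, with subtracted terms moved to the left.
  geomSum-closed : ∀ T → x * x * geomSum T + D ^ T * (D + suc T * x) ≡ β ^ suc T
  geomSum-closed zero    = base D x
    where
    base : ∀ D x → x * x * 0 + 1 * (D + 1 * x) ≡ (D + x) * 1
    base = solve-∀
  geomSum-closed (suc T) = trans (step D x T (geomSum T) (D ^ T)) (cong (β *_) (geomSum-closed T))
    where
    step : ∀ D x T f e → x * x * ((D + x) * f + suc T * e) + D * e * (D + suc (suc T) * x)
                       ≡ (D + x) * (x * x * f + e * (D + suc T * x))
    step = solve-∀

  -- The hypothesis on `b` reads `b t ≤ (t + 1) (D/β)^t Δ A`. As `1 − D/β = x/β`, the series
  -- `∑ (t + 1) (D/β)^t` is at most `β²/x²`, so the sum is at most `Δ β²/x² · A ≤ X A`. Multiplying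
  -- by `x² β^T` clears all denominators.
  ∑-geometric : ∀ {A X} (b : ℕ → ℕ) → 1 ≤ x → Δ * (β * β) ≤ x * x * X →
                (∀ t → β ^ t * b t ≤ suc t * (D ^ t * Δ) * A) →
                ∀ T → ∑ (downFrom T) b ≤ X * A
  ∑-geometric {A} {X} b 1≤x ΔββX b≤ T = *-cancelˡ-≤ (x * x * β ^ T) {{m*n≢0 (x * x) (β ^ T) {{m*n≢0 x x}} {{m^n≢0 β T}}}} (begin
    x * x * β ^ T * ∑ (downFrom T) b      ≡⟨ *-assoc (x * x) (β ^ T) _ ⟩
    x * x * (β ^ T * ∑ (downFrom T) b)    ≤⟨ *-monoʳ-≤ (x * x) (partial T) ⟩
    x * x * (β * geomSum T * (Δ * A))           ≡⟨ e₁ x β (geomSum T) Δ A ⟩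
    -- The closed form is used as an upper bound, its nonnegative correction term being dropped.
    x * x * geomSum T * (β * Δ * A)             ≤⟨ *-monoˡ-≤ (β * Δ * A) (m+n≤o⇒m≤o (x * x * geomSum T) (≤-reflexive (geomSum-closed T))) ⟩
    β ^ suc T * (β * Δ * A)               ≡⟨ e₂ β (β ^ T) Δ A ⟩
    Δ * (β * β) * (A * β ^ T)             ≤⟨ *-monoˡ-≤ (A * β ^ T) ΔββX ⟩
    x * x * X * (A * β ^ T)               ≡⟨ e₃ (x * x) X A (β ^ T) ⟩
    x * x * β ^ T * (X * A)               ∎)
    where
    open ≤-Reasoning
    instance
      x≢0 : NonZero x
      x≢0 = >-nonZero 1≤x
      β≢0 : NonZero β
      β≢0 = >-nonZero (≤-trans 1≤x (m≤n+m x D))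
    e₁ : ∀ x β f Δ A → x * x * (β * f * (Δ * A)) ≡ x * x * f * (β * Δ * A)
    e₁ = solve-∀
    e₂ : ∀ β p Δ A → β * p * (β * Δ * A) ≡ Δ * (β * β) * (A * p)
    e₂ = solve-∀
    e₃ : ∀ y X A p → y * X * (A * p) ≡ y * p * (X * A)
    e₃ = solve-∀
    -- Of `β ^ T`, a part `β ^ t` is spent on `b t`, leaving `β^(T − t)`. The terms of `geomSum T`
    -- carry only `β^(T − 1 − t)`, hence the extra factor `β` on the right.
    partial : ∀ T → β ^ T * ∑ (downFrom T) b ≤ β * geomSum T * (Δ * A)
    partial zero    = z≤n
    partial (suc T) = begin
      β * β ^ T * (b T + ∑ (downFrom T) b)                  ≡⟨ e₄ β (β ^ T) (b T) _ ⟩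
      β * (β ^ T * b T + β ^ T * ∑ (downFrom T) b)          ≤⟨ *-monoʳ-≤ β (+-mono-≤ (b≤ T) (partial T)) ⟩
      β * (suc T * (D ^ T * Δ) * A + β * geomSum T * (Δ * A))     ≡⟨ e₅ β T (D ^ T) Δ A (geomSum T) ⟩
      β * geomSum (suc T) * (Δ * A)                               ∎
      where
      e₄ : ∀ β p b s → β * p * (b + s) ≡ β * (p * b + p * s)
      e₄ = solve-∀
      e₅ : ∀ β T e Δ A f → β * (suc T * (e * Δ) * A + β * f * (Δ * A)) ≡ β * (β * f + suc T * e) * (Δ * A)
      e₅ = solve-∀

-- Cubic inequalities for the parameters

cube-reflects-≤ : ∀ {m n} → m ^ 3 ≤ n ^ 3 → m ≤ n
cube-reflects-≤ m³≤n³ = ≮⇒≥ λ n<m → <⇒≱ (^-monoˡ-< 3 n<m) m³≤n³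

cube-* : ∀ m n → (m * n) ^ 3 ≡ m ^ 3 * n ^ 3
cube-* = expanded
  where
  expanded : ∀ m n → m * n * (m * n * (m * n * 1)) ≡ m * (m * (m * 1)) * (n * (n * (n * 1)))
  expanded = solve-∀

-- Four times the left side is `4Δ⁵ + 8Δ³x + 4Δx²`. The first term is at most `2x³` by the summand
-- `2Δ⁵` of the hypothesis. The summand `512Δ⁴` makes `x` large enough, even for small `Δ`, for the
-- other two to be at most `x³` each.
cubic-bound : ∀ {Δ x} → 2 * Δ ^ 5 + 512 * Δ ^ 4 ≤ x ^ 3 → 1 ≤ Δ →
              Δ * ((Δ * Δ + x) * (Δ * Δ + x)) ≤ x * x * x
cubic-bound {Δ} {x} h 1≤Δ = *-cancelˡ-≤ 4 (begin
  4 * (Δ * ((Δ * Δ + x) * (Δ * Δ + x)))               ≡⟨ e₁ Δ x ⟩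
  2 * (2 * Δ ^ 5) + (8 * Δ ^ 3) * x + (4 * Δ) * x ^ 2  ≤⟨ +-mono-≤ (+-mono-≤ (*-monoʳ-≤ 2 2Δ⁵≤x³) (*-monoˡ-≤ x 8Δ³≤x²)) (*-monoˡ-≤ (x ^ 2) 4Δ≤x) ⟩
  2 * x ^ 3 + x ^ 2 * x + x * x ^ 2                   ≡⟨ e₂ x ⟩
  4 * (x * x * x)                                     ∎)
  where
  open ≤-Reasoning
  e₁ : ∀ Δ x → 4 * (Δ * ((Δ * Δ + x) * (Δ * Δ + x)))
             ≡ 2 * (2 * (Δ * (Δ * (Δ * (Δ * (Δ * 1)))))) + (8 * (Δ * (Δ * (Δ * 1)))) * x + (4 * Δ) * (x * (x * 1))
  e₁ = solve-∀
  e₂ : ∀ x → 2 * (x * (x * (x * 1))) + (x * (x * 1)) * x + x * (x * (x * 1)) ≡ 4 * (x * x * x)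
  e₂ = solve-∀
  2Δ⁵≤x³ : 2 * Δ ^ 5 ≤ x ^ 3
  2Δ⁵≤x³ = m+n≤o⇒m≤o (2 * Δ ^ 5) h
  512Δ⁴≤x³ : 512 * Δ ^ 4 ≤ x ^ 3
  512Δ⁴≤x³ = m+n≤o⇒n≤o (2 * Δ ^ 5) h
  4Δ≤x : 4 * Δ ≤ x
  4Δ≤x = cube-reflects-≤ (begin
    (4 * Δ) ^ 3     ≡⟨ e₃ Δ ⟩
    64 * Δ ^ 3 * 1  ≤⟨ *-mono-≤ (*-monoˡ-≤ (Δ ^ 3) (m≤m+n 64 448)) 1≤Δ ⟩
    512 * Δ ^ 3 * Δ ≡⟨ e₄ 512 Δ ⟩
    512 * Δ ^ 4     ≤⟨ 512Δ⁴≤x³ ⟩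
    x ^ 3           ∎)
    where
    e₃ : ∀ Δ → (4 * Δ) * ((4 * Δ) * ((4 * Δ) * 1)) ≡ 64 * (Δ * (Δ * (Δ * 1))) * 1
    e₃ = solve-∀
    e₄ : ∀ m Δ → m * (Δ * (Δ * (Δ * 1))) * Δ ≡ m * (Δ * (Δ * (Δ * (Δ * 1))))
    e₄ = solve-∀
  -- After cubing, the right side is `x³ · x³`; one factor is bounded below through `Δ⁵` and the
  -- other through `Δ⁴`, which together supply `Δ⁹`.
  8Δ³≤x² : 8 * Δ ^ 3 ≤ x ^ 2
  8Δ³≤x² = cube-reflects-≤ (begin
    (8 * Δ ^ 3) ^ 3                ≡⟨ e₅ Δ ⟩
    512 * Δ ^ 9                    ≤⟨ *-monoˡ-≤ (Δ ^ 9) (m≤m+n 512 512) ⟩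
    1024 * Δ ^ 9                   ≡⟨ e₆ Δ ⟩
    2 * Δ ^ 5 * (512 * Δ ^ 4)      ≤⟨ *-mono-≤ 2Δ⁵≤x³ 512Δ⁴≤x³ ⟩
    x ^ 3 * x ^ 3                  ≡⟨ e₇ x ⟩
    (x ^ 2) ^ 3                    ∎)
    where
    e₅ : ∀ Δ → (8 * Δ ^ 3) ^ 3 ≡ 512 * Δ ^ 9
    e₅ Δ = trans (cube-* 8 (Δ ^ 3)) (cong (512 *_) (^-*-assoc Δ 3 3))
    e₆ : ∀ Δ → 1024 * Δ ^ 9 ≡ 2 * Δ ^ 5 * (512 * Δ ^ 4)
    e₆ Δ = trans (cong (1024 *_) (^-distribˡ-+-* Δ 5 4)) (e (Δ ^ 5) (Δ ^ 4))
      where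
      e : ∀ a b → 1024 * (a * b) ≡ 2 * a * (512 * b)
      e = solve-∀
    e₇ : ∀ x → x ^ 3 * x ^ 3 ≡ (x ^ 2) ^ 3
    e₇ x = trans (sym (^-distribˡ-+-* x 3 3)) (sym (^-*-assoc x 2 3))

-- Here `x` is at least half of `p + q` up to rounding. Giving up half of `q`, where `q ≥ 2`,
-- absorbs the rounding and leaves `4x ≥ 2p + q`. Then `64x³ ≥ 8p³ + q³`, and the constants fit
-- because `8 · 16 = 64 · 2` and `32³ = 64 · 512`.
parameters-suffice : ∀ {Δ p q x} → 1 ≤ Δ → 16 * Δ ^ 5 ≤ p ^ 3 → 32 ^ 3 * Δ ^ 4 ≤ q ^ 3 →
                     p + q ≤ 2 * x + 1 → 2 * Δ ^ 5 + 512 * Δ ^ 4 ≤ x ^ 3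
parameters-suffice {Δ} {p} {q} {x} 1≤Δ p-large q-large x-large = *-cancelˡ-≤ 64 (begin
  64 * (2 * Δ ^ 5 + 512 * Δ ^ 4)           ≡⟨ e₁ (Δ ^ 5) (Δ ^ 4) ⟩
  8 * (16 * Δ ^ 5) + 32768 * Δ ^ 4         ≤⟨ +-mono-≤ (*-monoʳ-≤ 8 p-large) q-large ⟩
  8 * p ^ 3 + q ^ 3                        ≤⟨ m≤m+n _ _ ⟩
  8 * p ^ 3 + q ^ 3 + (12 * (p ^ 2 * q) + 6 * (p * q ^ 2))  ≡⟨ e₂ p q ⟩
  (2 * p + q) ^ 3                          ≤⟨ ^-monoˡ-≤ 3 2p+q≤4x ⟩
  (4 * x) ^ 3                              ≡⟨ cube-* 4 x ⟩
  64 * x ^ 3                               ∎)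
  where
  open ≤-Reasoning
  e₁ : ∀ a b → 64 * (2 * a + 512 * b) ≡ 8 * (16 * a) + 32768 * b
  e₁ = solve-∀
  e₂ : ∀ p q → 8 * (p * (p * (p * 1))) + q * (q * (q * 1)) + (12 * (p * (p * 1) * q) + 6 * (p * (q * (q * 1))))
             ≡ (2 * p + q) * ((2 * p + q) * ((2 * p + q) * 1))
  e₂ = solve-∀
  e₃ : ∀ p q → 2 * p + q + q ≡ 2 * (p + q)
  e₃ = solve-∀
  e₄ : ∀ x → 2 * (2 * x + 1) ≡ 4 * x + 2
  e₄ = solve-∀
  2≤q : 2 ≤ q
  2≤q = cube-reflects-≤ (≤-trans (*-mono-≤ (m≤m+n 8 32760) (^-monoˡ-≤ 4 1≤Δ)) q-large)
  2p+q≤4x : 2 * p + q ≤ 4 * x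
  2p+q≤4x = +-cancelʳ-≤ 2 _ _ (begin
    2 * p + q + 2    ≤⟨ +-monoʳ-≤ (2 * p + q) 2≤q ⟩
    2 * p + q + q    ≡⟨ e₃ p q ⟩
    2 * (p + q)      ≤⟨ *-monoʳ-≤ 2 x-large ⟩
    2 * (2 * x + 1)  ≡⟨ e₄ x ⟩
    4 * x + 2        ∎)

-- The induction

Linked-tabulate : ∀ {R : A → A → Set} {m} (p : Fin m → A) →
                  (∀ i j → toℕ j ≡ suc (toℕ i) → R (p i) (p j)) → Linked R (tabulate p)
Linked-tabulate {m = 0}           p step = []
Linked-tabulate {m = 1}           p step = [-]
Linked-tabulate {m = suc (suc m)} p step =
  step zero (suc zero) refl ∷ Linked-tabulate (p ∘ suc) λ i j eq → step (suc i) (suc j) (cong suc eq)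

tabulate-+ : ∀ s {t} (p : Fin (s + t) → A) →
             tabulate p ≡ tabulate (p ∘ (_↑ˡ t)) ++ tabulate (p ∘ (s ↑ʳ_))
tabulate-+ zero    p = refl
tabulate-+ (suc s) p = cong (p zero ∷_) (tabulate-+ s (p ∘ suc))

HalvesAgree-tabulate : ∀ {f : A → B} {t} (p : Fin (t + t) → A) →
                       (∀ i → f (p (i ↑ˡ t)) ≡ f (p (t ↑ʳ i))) → HalvesAgree f t (tabulate p)
HalvesAgree-tabulate {f = f} {t} p eq rewrite tabulate-+ t p =
  subst (λ s → map f (take s (as ++ bs)) ≡ map f (drop s (as ++ bs))) (length-tabulate (p ∘ (_↑ˡ t))) (begin
    map f (take (length as) (as ++ bs))  ≡⟨ cong (map f) (take-length-++ as) ⟩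
    map f as                             ≡⟨ map-tabulate (p ∘ (_↑ˡ t)) f ⟩
    tabulate (f ∘ p ∘ (_↑ˡ t))           ≡⟨ tabulate-cong eq ⟩
    tabulate (f ∘ p ∘ (t ↑ʳ_))           ≡⟨ map-tabulate (p ∘ (t ↑ʳ_)) f ⟨
    map f bs                             ≡⟨ cong (map f) (drop-length-++ as) ⟨
    map f (drop (length as) (as ++ bs))  ∎)
  where
  open ≡-Reasoning
  as = tabulate (p ∘ (_↑ˡ t))
  bs = tabulate (p ∘ (t ↑ʳ_))

Unique⇒lookup-injective : ∀ {xs : List A} → Unique xs → ∀ {i j} → lookup xs i ≡ lookup xs j → i ≡ j
Unique⇒lookup-injective (x∉ ∷ _) {zero}  {zero}  _  = refl
Unique⇒lookup-injective (x∉ ∷ _) {zero}  {suc j} eq = contradiction eq (All.lookup x∉ (∈-lookup j))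
Unique⇒lookup-injective (x∉ ∷ _) {suc i} {zero}  eq = contradiction (sym eq) (All.lookup x∉ (∈-lookup i))
Unique⇒lookup-injective (_ ∷ u)  {suc i} {suc j} eq = cong suc (Unique⇒lookup-injective u eq)

Unique-++⇒disjoint : ∀ (xs : List A) {ys} → Unique (xs ++ ys) → All (λ x → All (x ≢_) ys) xs
Unique-++⇒disjoint []       _         = []
Unique-++⇒disjoint (x ∷ xs) (x∉ ∷ u) = All.++⁻ʳ xs x∉ ∷ Unique-++⇒disjoint xs u

module _ {n : ℕ} where

  open DecMembership (Fin._≟_ {n}) using (_∈?_)

  infixl 6 _∖_

  _∖_ : List (Fin n) → List (Fin n) → List (Fin n)
  S ∖ R = filter (λ u → ¬? (u ∈? R)) S

  ∈-∖⁺ : ∀ {u S R} → u ∈ S → u ∉ R → u ∈ S ∖ R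
  ∈-∖⁺ = ∈-filter⁺ _

  ∈-∖⁻ : ∀ {u S} R → u ∈ S ∖ R → u ∈ S × u ∉ R
  ∈-∖⁻ R = ∈-filter⁻ (λ u → ¬? (u ∈? R))

  length-∖-< : ∀ {u S} → u ∈ S → length (S ∖ (u ∷ [])) < length S
  length-∖-< u∈S = filter-notAll _ _ (Any.map (λ { refl u∉ → u∉ (here refl) }) u∈S)

  module Counting
    (G : Graph n) {Δ} (degree≤Δ : ∀ v → degree G v ≤ Δ)
    {k} (option : Fin n → Fin k → ℕ) (option-injective : ∀ v {c d} → option v c ≡ option v d → c ≡ d)
    {x X} (1≤x : 1 ≤ x) (ΔββX : Δ * ((Δ * Δ + x) * (Δ * Δ + x)) ≤ x * x * X) (β+X≤k : Δ * Δ + x + X ≤ k)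
    where

    open Walks G
    open Colourings option option-injective

    private
      β = Δ * Δ + x

    1≤β : 1 ≤ β
    1≤β = ≤-trans 1≤x (m≤n+m x (Δ * Δ))

    β≤k : β ≤ k
    β≤k = m+n≤o⇒m≤o β β+X≤k

    instance
      k≢0 : NonZero k
      k≢0 = >-nonZero (≤-trans 1≤β β≤k)

    abstract
      repetition? : ∀ φ t xs → Dec (Repetition (colour φ) t xs)
      repetition? φ t xs = map′ (λ (u , a) → repetition u a) (λ r → Repetition.unique r , Repetition.agree r)
        (DecUnique.unique? Fin._≟_ xs ×-dec ≡-dec _≟_ _ _)

    -- Orders up to n suffice, as a path has at most n vertices.
    record Good (S : List (Fin n)) (φ : Vec (Fin k) n) : Set where
      constructor mkGood
      field
        avoids : ∀ {t v xs} → t < n → xs ∈ pathsThrough (suc t) v → All (_∈ S) xs →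
                 ¬ Repetition (colour φ) (suc t) xs
    open Good

    abstract
      good? : ∀ S φ → Dec (Good S φ)
      good? S φ = map′
        (λ good → mkGood λ t<n xs∈ xs⊆S rep →
          All.lookup (All.lookup (All.lookup good (∈-downFrom⁺ t<n)) (∈-allFin _)) xs∈ (xs⊆S , rep))
        (λ (mkGood good) → All.tabulate λ t∈ → All.tabulate λ _ → All.tabulate λ xs∈ (xs⊆S , rep) →
          good (∈-downFrom⁻ t∈) xs∈ xs⊆S rep)
        (All.all? (λ t → All.all? (λ v → All.all? (λ xs →
          ¬? (All.all? (_∈? S) xs ×-dec repetition? φ (suc t) xs)) (pathsThrough (suc t) v)) (allFin n)) (downFrom n))

    N : List (Fin n) → ℕ
    N S = ∫ (𝟙 ∘ good? S)

    good-⊆ : ∀ {S S′ φ} → S ⊆ S′ → Good S′ φ → Good S φ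
    good-⊆ S⊆S′ good = mkGood λ t<n xs∈ xs⊆S → avoids good t<n xs∈ (All.map S⊆S′ xs⊆S)

    N-antitone : ∀ {S S′} → S ⊆ S′ → N S′ ≤ N S
    N-antitone S⊆S′ = ∫-mono λ φ → 𝟙-mono (good? _ φ) (good? _ φ) (good-⊆ S⊆S′)

    good-cong : ∀ {S} φ ψ → (∀ {u} → u ∈ S → colour ψ u ≡ colour φ u) → Good S φ → Good S ψ
    good-cong φ ψ eq good = mkGood λ {t} t<n xs∈ xs⊆S (repetition u agree) →
      let eqs = All.map eq xs⊆S in
      avoids good t<n xs∈ xs⊆S (repetition u
        (trans (sym (map-cong-local (All.take⁺ (suc t) eqs)))
               (trans agree (map-cong-local (All.drop⁺ (suc t) eqs)))))

    -- Goodness on `S ∖ R` tests only paths avoiding `R`, so recolouring a vertex of `R` cannot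
    -- affect it. This independence is what allows the first half of a repetition to be resampled.
    good-ignores : ∀ {S R r} → r ∈ R → IgnoresColourOf (𝟙 ∘ good? (S ∖ R)) r
    good-ignores {S} {R} {r} r∈R φ c = ≤-antisym
      (𝟙-mono (good? _ _) (good? _ _) (good-cong (φ [ r ]≔ c) φ (sym ∘ unchanged)))
      (𝟙-mono (good? _ _) (good? _ _) (good-cong φ (φ [ r ]≔ c) unchanged))
      where
      unchanged : ∀ {u} → u ∈ S ∖ R → colour (φ [ r ]≔ c) u ≡ colour φ u
      unchanged u∈ = colour-update-≢ φ c λ { refl → proj₂ (∈-∖⁻ {S = S} R u∈) r∈R }

    -- A repetitive path inside `v ∷ S` either misses `v`, and then lies in `S`, or contains `v`,
    -- and then `refocus` turns it into one with `v` in its first half.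
    good-extend : ∀ {S v φ} → Good S φ →
                  (∀ {t xs} → t < n → xs ∈ pathsThrough (suc t) v → ¬ Repetition (colour φ) (suc t) xs) →
                  Good (v ∷ S) φ
    good-extend {S} {v} {φ} good avoids-v = mkGood extended
      where
      extended : ∀ {t u xs} → t < n → xs ∈ pathsThrough (suc t) u → All (_∈ v ∷ S) xs →
                 ¬ Repetition (colour φ) (suc t) xs
      extended {t} {xs = xs} t<n xs∈ xs⊆ rep with v ∈? xs
      ... | yes v∈ = let linked , len , _ = ∈-pathsThrough⁻ {suc t} xs∈
                         _ , ys∈ , rep′ = refocus linked len rep v∈
                     in avoids-v {t} t<n ys∈ rep′
      ... | no v∉  = avoids good {t} t<n xs∈ (All.tabulate within) rep
        where
        within : ∀ {w} → w ∈ xs → w ∈ S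
        within w∈ with All.lookup xs⊆ w∈
        ... | here refl = contradiction w∈ v∉
        ... | there w∈S = w∈S

    bad : List (Fin n) → ℕ → List (Fin n) → ℕ
    bad S t xs = ∫ λ φ → 𝟙 (good? S φ) * 𝟙 (repetition? φ (suc t) xs)

    -- A union bound: a colouring good on `S` but not on `v ∷ S` has, by `good-extend`, a repetition
    -- on some path through `v`. The sum runs over all such paths, whether or not they stay inside
    -- `v ∷ S`.
    N-extend : ∀ S v → N S ≤ N (v ∷ S) + ∑ (downFrom n) λ t → ∑ (pathsThrough (suc t) v) (bad S t)
    N-extend S v = begin
      N S
        ≤⟨ ∫-mono pointwise ⟩
      ∫ (λ φ → 𝟙 (good? (v ∷ S) φ) + ∑ (downFrom n) λ t → ∑ (pathsThrough (suc t) v) (badAt φ t))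
        ≡⟨ ∫-distrib-+ (𝟙 ∘ good? (v ∷ S)) (λ φ → ∑ (downFrom n) λ t → ∑ (pathsThrough (suc t) v) (badAt φ t)) ⟩
      N (v ∷ S) + ∫ (λ φ → ∑ (downFrom n) λ t → ∑ (pathsThrough (suc t) v) (badAt φ t))
        ≡⟨ cong (N (v ∷ S) +_) (∫-∑ (downFrom n) λ t φ → ∑ (pathsThrough (suc t) v) (badAt φ t)) ⟩
      N (v ∷ S) + ∑ (downFrom n) (λ t → ∫ λ φ → ∑ (pathsThrough (suc t) v) (badAt φ t))
        ≡⟨ cong (N (v ∷ S) +_) (∑-cong (downFrom n) λ t → ∫-∑ (pathsThrough (suc t) v) (λ xs φ → badAt φ t xs)) ⟩
      N (v ∷ S) + ∑ (downFrom n) (λ t → ∑ (pathsThrough (suc t) v) (bad S t)) ∎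
      where
      open ≤-Reasoning
      badAt : Vec (Fin k) n → ℕ → List (Fin n) → ℕ
      badAt φ t xs = 𝟙 (good? S φ) * 𝟙 (repetition? φ (suc t) xs)
      pointwise : ∀ φ → 𝟙 (good? S φ) ≤
        𝟙 (good? (v ∷ S) φ) + ∑ (downFrom n) λ t → ∑ (pathsThrough (suc t) v) (badAt φ t)
      pointwise φ = 𝟙≤ (good? S φ) λ good → by-cases good
        (Any.any? (λ t → Any.any? (repetition? φ (suc t)) (pathsThrough (suc t) v)) (downFrom n))
        where
        by-cases : Good S φ → Dec (Any (λ t → Any (Repetition (colour φ) (suc t)) (pathsThrough (suc t) v)) (downFrom n)) →
          1 ≤ 𝟙 (good? (v ∷ S) φ) + ∑ (downFrom n) λ t → ∑ (pathsThrough (suc t) v) (badAt φ t)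
        by-cases good (yes found) =
          let t , t∈ , found-t = find found
              xs , xs∈ , rep   = find found-t
          in begin
            1                                                                 ≤⟨ *-mono-≤ (1≤𝟙 (good? S φ) good) (1≤𝟙 (repetition? φ (suc t) xs) rep) ⟩
            badAt φ t xs                                                      ≤⟨ ∈⇒≤∑ (badAt φ t) xs∈ ⟩
            ∑ (pathsThrough (suc t) v) (badAt φ t)                            ≤⟨ ∈⇒≤∑ (λ t → ∑ (pathsThrough (suc t) v) (badAt φ t)) t∈ ⟩
            ∑ (downFrom n) (λ t → ∑ (pathsThrough (suc t) v) (badAt φ t))     ≤⟨ m≤n+m _ (𝟙 (good? (v ∷ S) φ)) ⟩
            𝟙 (good? (v ∷ S) φ) + ∑ (downFrom n) (λ t → ∑ (pathsThrough (suc t) v) (badAt φ t)) ∎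
        by-cases good (no ¬found) = m≤n⇒m≤n+o _ (1≤𝟙 (good? (v ∷ S) φ)
          (good-extend good λ {t} t<n xs∈ rep → ¬found (lose {x = t} (∈-downFrom⁺ t<n) (lose xs∈ rep))))

    -- The colours of the first half of a repetition are determined by those of the second.
    bad-bound : ∀ S {t xs} → length xs ≡ suc t + suc t →
                k ^ suc t * bad S t xs ≤ N (S ∖ take (suc t) xs)
    bad-bound S {t} {xs} len with DecUnique.unique? Fin._≟_ xs
    ... | no ¬uniq = begin
      k ^ suc t * bad S t xs         ≤⟨ *-monoʳ-≤ (k ^ suc t) (∫-mono {g = λ _ → 0} λ φ →
        ≤-trans (*-monoʳ-≤ (𝟙 (good? S φ)) (𝟙≤ (repetition? φ (suc t) xs) λ rep → contradiction (Repetition.unique rep) ¬uniq))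
                (≤-reflexive (*-zeroʳ (𝟙 (good? S φ))))) ⟩
      k ^ suc t * ∫ {n = n} (λ _ → 0)  ≡⟨ cong (k ^ suc t *_) (∫-∑ {A = ℕ} {n = n} [] λ _ _ → 0) ⟩
      k ^ suc t * 0                  ≡⟨ *-zeroʳ (k ^ suc t) ⟩
      0                              ≤⟨ z≤n ⟩
      N (S ∖ take (suc t) xs)        ∎
      where open ≤-Reasoning
    ... | yes uniq = begin
      k ^ suc t * bad S t xs                                      ≤⟨ *-monoʳ-≤ (k ^ suc t) (∫-mono pointwise) ⟩
      k ^ suc t * ∫ (λ φ → 𝟙 (good? (S ∖ as) φ) * matches as bs φ)  ≡⟨ cong (λ m → k ^ m * ∫ (λ φ → 𝟙 (good? (S ∖ as) φ) * matches as bs φ)) (length-first-half {t = suc t} {xs} len) ⟨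
      k ^ length as * ∫ (λ φ → 𝟙 (good? (S ∖ as) φ) * matches as bs φ)  ≤⟨ ∫-matches (𝟙 ∘ good? (S ∖ as)) as bs
          (Unique.take⁺ (suc t) uniq)
          (Unique-++⇒disjoint as (subst Unique (sym (take++drop≡id (suc t) xs)) uniq))
          (trans (length-first-half {t = suc t} {xs} len) (sym (length-second-half {t = suc t} {xs} len)))
          (All.tabulate (good-ignores {S})) ⟩
      N (S ∖ as)                                                  ∎
      where
      open ≤-Reasoning
      as = take (suc t) xs
      bs = drop (suc t) xs
      -- Goodness is weakened from `S` to `S ∖ as` so that it ignores the colours on `as`.
      pointwise : ∀ φ → 𝟙 (good? S φ) * 𝟙 (repetition? φ (suc t) xs) ≤ 𝟙 (good? (S ∖ as) φ) * matches as bs φ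
      pointwise φ = *-mono-≤ (𝟙-mono (good? S φ) (good? (S ∖ as) φ) (good-⊆ (proj₁ ∘ ∈-∖⁻ {S = S} as)))
        (𝟙≤ (repetition? φ (suc t) xs) λ rep → ≡⇒matches as bs φ (Repetition.agree rep))

    Grows : List (Fin n) → Set
    Grows S = ∀ {v} → v ∉ S → β * N S ≤ k * N (v ∷ S)

    module _ {m} (grows : ∀ {S} → length S < m → Grows S) where

      -- Each vertex of `R` costs a factor `k/β`: if `r` is in `S`, then `S ∖ (r ∷ [])` is shorter
      -- than `S`, and `grows` applies to putting `r` back.
      N-∖ : ∀ R {S} → length S ≤ m → β ^ length R * N (S ∖ R) ≤ k ^ length R * N S
      N-∖ []      {S} _ = *-monoʳ-≤ 1 (N-antitone λ u∈S → ∈-∖⁺ u∈S λ ())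
      N-∖ (r ∷ R) {S} |S|≤m = begin
        β * β ^ length R * N (S ∖ (r ∷ R))     ≤⟨ *-monoʳ-≤ (β * β ^ length R) (N-antitone {S′ ∖ R} removed) ⟩
        β * β ^ length R * N (S′ ∖ R)          ≡⟨ *-assoc β (β ^ length R) _ ⟩
        β * (β ^ length R * N (S′ ∖ R))        ≤⟨ *-monoʳ-≤ β (N-∖ R (≤-trans (length-filter _ S) |S|≤m)) ⟩
        β * (k ^ length R * N S′)              ≡⟨ e₁ β (k ^ length R) (N S′) ⟩
        k ^ length R * (β * N S′)              ≤⟨ *-monoʳ-≤ (k ^ length R) remove-one ⟩
        k ^ length R * (k * N S)               ≡⟨ e₂ (k ^ length R) k (N S) ⟩
        k * k ^ length R * N S                 ∎
        where
        open ≤-Reasoning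
        S′ = S ∖ (r ∷ [])
        e₁ : ∀ a b c → a * (b * c) ≡ b * (a * c)
        e₁ = solve-∀
        e₂ : ∀ a b c → a * (b * c) ≡ b * a * c
        e₂ = solve-∀
        removed : S′ ∖ R ⊆ S ∖ (r ∷ R)
        removed u∈ =
          let u∈S′ , u∉R = ∈-∖⁻ {S = S′} R u∈
              u∈S , u∉r  = ∈-∖⁻ {S = S} (r ∷ []) u∈S′
          in ∈-∖⁺ u∈S λ { (here refl) → u∉r (here refl) ; (there u∈R) → u∉R u∈R }
        remove-one : β * N S′ ≤ k * N S
        remove-one with r ∈? S
        ... | yes r∈S = ≤-trans
          (grows (<-≤-trans (length-∖-< r∈S) |S|≤m) λ r∈S′ → proj₂ (∈-∖⁻ {S = S} (r ∷ []) r∈S′) (here refl))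
          (*-monoʳ-≤ k (N-antitone restore))
          where
          restore : S ⊆ r ∷ S′
          restore {u} u∈S with u Fin.≟ r
          ... | yes refl = here refl
          ... | no  u≢r  = there (∈-∖⁺ u∈S λ { (here u≡r) → u≢r u≡r })
        -- A path through `v` may leave `S`, or its list may repeat a vertex already removed. In
        -- either case nothing is taken away here, and `β ≤ k` covers the factor.
        ... | no r∉S = *-mono-≤ β≤k (N-antitone λ u∈S → ∈-∖⁺ u∈S λ { (here refl) → r∉S u∈S })

      -- Since `v` is in the first half but not in `S`, deleting that half from `S` takes only `t`
      -- removals, not `t + 1`. They cost `(k/β)^t` against the gain `k^(t + 1)` of `bad-bound`,
      -- which leaves one factor `k` over.
      bad-bound-N : ∀ {S v t xs} → length S ≤ m → v ∉ S → xs ∈ pathsThrough (suc t) v →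
                    β ^ t * (k * bad S t xs) ≤ N S
      bad-bound-N {S} {v} {t} {xs} |S|≤m v∉S xs∈
        with linked , len , v∈as ← ∈-pathsThrough⁻ {suc t} xs∈
        with ys , zs , as≡ ← ∈-∃++ v∈as = *-cancelˡ-≤ (k ^ t) {{m^n≢0 k t}} (begin
          k ^ t * (β ^ t * (k * bad S t xs))           ≡⟨ e (k ^ t) (β ^ t) k (bad S t xs) ⟩
          β ^ t * (k ^ suc t * bad S t xs)             ≤⟨ *-monoʳ-≤ (β ^ t) (bad-bound S len) ⟩
          β ^ t * N (S ∖ take (suc t) xs)              ≤⟨ *-monoʳ-≤ (β ^ t) (N-antitone keep-v) ⟩
          β ^ t * N (S ∖ (ys ++ zs))                   ≡⟨ cong (λ l → β ^ l * N (S ∖ (ys ++ zs))) length-rest ⟨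
          β ^ length (ys ++ zs) * N (S ∖ (ys ++ zs))   ≤⟨ N-∖ (ys ++ zs) |S|≤m ⟩
          k ^ length (ys ++ zs) * N S                  ≡⟨ cong (λ l → k ^ l * N S) length-rest ⟩
          k ^ t * N S                                  ∎)
        where
        open ≤-Reasoning
        e : ∀ a b k c → a * (b * (k * c)) ≡ b * (k * a * c)
        e = solve-∀
        length-rest : length (ys ++ zs) ≡ t
        length-rest = suc-injective (trans (sym (length-++-sucʳ ys v zs))
          (trans (cong length (sym as≡)) (length-first-half {t = suc t} {xs} len)))
        keep-v : S ∖ (ys ++ zs) ⊆ S ∖ take (suc t) xs
        keep-v {u} u∈ with ∈-∖⁻ (ys ++ zs) u∈
        ... | u∈S , u∉ = ∈-∖⁺ u∈S λ u∈as → u∉ (without (subst (u ∈_) as≡ u∈as))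
          where
          without : u ∈ ys ++ v ∷ zs → u ∈ ys ++ zs
          without u∈ with ∈-++⁻ ys u∈
          ... | inj₁ u∈ys         = ∈-++⁺ˡ u∈ys
          ... | inj₂ (here refl)  = contradiction u∈S v∉S
          ... | inj₂ (there u∈zs) = ∈-++⁺ʳ ys u∈zs

      -- By `β + X ≤ k`, the quantity `k * N S` contains both `β * N S` and `X * N S`. The latter
      -- pays for all colourings lost to repetitions through `v`, and cancelling it leaves the
      -- claim.
      grows-step : ∀ {S} → length S ≤ m → Grows S
      grows-step {S} |S|≤m {v} v∉S = +-cancelʳ-≤ (X * N S) _ _ (begin
        β * N S + X * N S                      ≡⟨ *-distribʳ-+ (N S) β X ⟨
        (β + X) * N S                          ≤⟨ *-monoˡ-≤ (N S) β+X≤k ⟩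
        k * N S                                ≤⟨ *-monoʳ-≤ k (N-extend S v) ⟩
        k * (N (v ∷ S) + ∑ (downFrom n) λ t → ∑ (pathsThrough (suc t) v) (bad S t))
                                               ≡⟨ *-distribˡ-+ k (N (v ∷ S)) _ ⟩
        k * N (v ∷ S) + k * (∑ (downFrom n) λ t → ∑ (pathsThrough (suc t) v) (bad S t))
                                               ≡⟨ cong (k * N (v ∷ S) +_) (trans (*-distribˡ-∑ (downFrom n) k _)
                                                    (∑-cong (downFrom n) λ t → *-distribˡ-∑ (pathsThrough (suc t) v) k _)) ⟩
        k * N (v ∷ S) + ∑ (downFrom n) b       ≤⟨ +-monoʳ-≤ (k * N (v ∷ S)) (∑-geometric Δ x b 1≤x ΔββX b-bound n) ⟩
        k * N (v ∷ S) + X * N S                ∎)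
        where
        open ≤-Reasoning
        b : ℕ → ℕ
        b t = ∑ (pathsThrough (suc t) v) λ xs → k * bad S t xs
        b-bound : ∀ t → β ^ t * b t ≤ suc t * ((Δ * Δ) ^ t * Δ) * N S
        b-bound t = begin
          β ^ t * b t                                                  ≡⟨ *-distribˡ-∑ (pathsThrough (suc t) v) (β ^ t) _ ⟩
          ∑ (pathsThrough (suc t) v) (λ xs → β ^ t * (k * bad S t xs)) ≤⟨ ∑-mono (pathsThrough (suc t) v) (bad-bound-N {t = t} |S|≤m v∉S) ⟩
          ∑ (pathsThrough (suc t) v) (λ _ → N S)                       ≡⟨ ∑-const (pathsThrough (suc t) v) (N S) ⟩
          length (pathsThrough (suc t) v) * N S                        ≤⟨ *-monoˡ-≤ (N S) (length-pathsThrough degree≤Δ t v) ⟩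
          suc t * ((Δ * Δ) ^ t * Δ) * N S                              ∎

    grows-all : ∀ m {S} → length S < m → Grows S
    grows-all (suc m) (s≤s |S|≤m) = grows-step (grows-all m) |S|≤m

    N-positive : ∀ S → 1 ≤ N S
    N-positive [] = ∫-positive λ φ → 1≤𝟙 (good? [] φ) (none {φ})
      where
      none : ∀ {φ} → Good [] φ
      -- No listed path fits inside the empty set: the empty list is excluded because `v` lies in
      -- the first half.
      none = mkGood λ
        { {t} _ xs∈ []      _ → case proj₂ (proj₂ (∈-pathsThrough⁻ {suc t} xs∈)) of λ ()
        ; _ _ (() ∷ _) _ }
    N-positive (v ∷ S) with v ∈? S
    ... | yes v∈S = ≤-trans (N-positive S) (N-antitone λ { (here refl) → v∈S ; (there u∈S) → u∈S })
    ... | no  v∉S = >-nonZero⁻¹ _ {{m*n≢0⇒n≢0 k {{>-nonZero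
        (≤-trans (*-mono-≤ 1≤β (N-positive S)) (grows-all (suc (length S)) ≤-refl v∉S))}}}}

    nonrepetitive-colouring : ∃ λ φ → Nonrepetitive G (colour φ)
    nonrepetitive-colouring with ∫-witness (good? (allFin n)) (N-positive (allFin n))
    ... | φ , mkGood good = φ , nonrepetitive
      where
      nonrepetitive : Nonrepetitive G (colour φ)
      -- Injectivity of `p` gives `2(t + 1) ≤ n`, hence `t < n`. The path is found among those
      -- through its first vertex, with nothing before it.
      nonrepetitive (suc t) _ p (p-injective , p-adjacent) rep = good
        (m+n≤o⇒m≤o (suc t) (Fin.injective⇒≤ p-injective))
        (∈-pathsThrough⁺ {suc t} [] (Linked-tabulate p p-adjacent) (length-tabulate p) (s≤s z≤n))
        (All.tabulate λ _ → ∈-allFin _)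
        (repetition (Unique.tabulate⁺ p-injective) (HalvesAgree-tabulate p rep))

-- Maximum degree, lists and the choice of parameters

∈⇒≤foldr-⊔ : ∀ {m ms} → m ∈ ms → m ≤ foldr _⊔_ 0 ms
∈⇒≤foldr-⊔ (here refl) = m≤m⊔n _ _
∈⇒≤foldr-⊔ (there m∈)  = m≤n⇒m≤o⊔n _ (∈⇒≤foldr-⊔ m∈)

degree≤maxDegree : ∀ {n} (G : Graph n) v → degree G v ≤ maxDegree G
degree≤maxDegree G v = ∈⇒≤foldr-⊔ (∈-map⁺ (degree G) (∈-allFin v))

n≤2⌊n/2⌋+1 : ∀ n → n ≤ 2 * ⌊ n /2⌋ + 1
n≤2⌊n/2⌋+1 n = begin
  n                            ≡⟨ ⌊n/2⌋+⌈n/2⌉≡n n ⟨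
  ⌊ n /2⌋ + ⌈ n /2⌉            ≤⟨ +-monoʳ-≤ ⌊ n /2⌋ (⌊n/2⌋-mono (n≤1+n (suc n))) ⟩
  ⌊ n /2⌋ + suc ⌊ n /2⌋        ≡⟨ e ⌊ n /2⌋ ⟩
  2 * ⌊ n /2⌋ + 1              ∎
  where
  open ≤-Reasoning
  e : ∀ m → m + suc m ≡ 2 * m + 1
  e = solve-∀

-- The conditions on `p` and `q` say `p ≥ 2^(4/3) Δ^(5/3)` and `q ≥ C Δ^(4/3)`, cubed to stay within
-- the natural numbers. Rounding these two terms up separately adds less than 2, which a larger
-- constant absorbs.
theorem31 : ∃[ C ] (∀ (n : ℕ) (G : Graph n) (Δ : ℕ) → maxDegree G ≡ Δ → 2 ≤ Δ →
    ∀ (k p q : ℕ) → 16 * Δ ^ 5 ≤ p ^ 3 → C ^ 3 * Δ ^ 4 ≤ q ^ 3 →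
    Δ ^ 2 + p + q ≤ k → πch≤ G k)
theorem31 = 32 , λ n G Δ maxDegree≡Δ 2≤Δ k p q p-large q-large k-large L lists →
  -- The excess `s` of `k` over `Δ²` is split evenly, so that `Δ² + x + X = k`. As `x` is the lower
  -- half, `x ≤ X`, and it suffices to bound `Δ β²` by `x³`.
  let s        = k ∸ Δ * Δ
      x        = ⌊ s /2⌋
      X        = ⌈ s /2⌉
      1≤Δ      = ≤-trans (n≤1+n 1) 2≤Δ
      Δ²+p+q≤k = subst (λ D → Δ * D + p + q ≤ k) (*-identityʳ Δ) k-large
      p+q≤s    = subst (_≤ s) (m+n∸m≡n (Δ * Δ) (p + q))
                   (∸-monoˡ-≤ (Δ * Δ) (subst (_≤ k) (+-assoc (Δ * Δ) p q) Δ²+p+q≤k))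
      x³-large = parameters-suffice {p = p} {q} {x} 1≤Δ p-large q-large (≤-trans p+q≤s (n≤2⌊n/2⌋+1 s))
      1≤x      = cube-reflects-≤ (≤-trans (*-mono-≤ (n≤1+n 1) (^-monoˡ-≤ 5 1≤Δ)) (m+n≤o⇒m≤o (2 * Δ ^ 5) x³-large))
      -- Only the first `k` colours of each list are used, so every vertex has exactly `k` options.
      option   = λ v c → lookup (L v) (Fin.inject≤ c (proj₂ (lists v)))
      injective = λ v {c} {d} → Fin.inject≤-injective _ _ c d ∘ Unique⇒lookup-injective (proj₁ (lists v))
      φ , good = Counting.nonrepetitive-colouring G
        (λ v → subst (degree G v ≤_) maxDegree≡Δ (degree≤maxDegree G v))
        option injective
        1≤x
        (≤-trans (cubic-bound x³-large 1≤Δ) (*-monoʳ-≤ (x * x) (⌊n/2⌋≤⌈n/2⌉ s)))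
        (≤-reflexive (trans (+-assoc (Δ * Δ) x X)
          (trans (cong (Δ * Δ +_) (⌊n/2⌋+⌈n/2⌉≡n s))
                 (m+[n∸m]≡n (m+n≤o⇒m≤o (Δ * Δ) (m+n≤o⇒m≤o (Δ * Δ + p) Δ²+p+q≤k))))))
  in Colourings.colour option injective φ , (λ v → ∈-lookup {xs = L v} _) , good
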